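{- Let $G$ be the graph of an orthogonal array $\mathrm{OA}(k,m)$. The VC-dimension of $G$ is at most $k(k-1)$.
   Context: All graphs are finite and simple. An orthogonal array $\mathrm{OA}(k,m)$ is a $k\times m^2$ matrix with entries in $[m]=\{1,\dots,m\}$ such that, in any $2\times m^2$ submatrix, all possible ordered pairs in $[m]\times[m]$ appear as columns. The graph of an $\mathrm{OA}(k,m)$ has the $m^2$ columns of the array as vertices, and two distinct columns are adjacent if and only if they agree in some row (coordinate). The VC-dimension of a graph $G$ is the maximum size of a set $S\subseteq V(G)$ that is shattered, meaning that for every $A\subseteq S$ there is a vertex $u\in V(G)$ (possibly $u\in S$) with $N(u)\cap S=A$, where $N(u)$ is the open neighborhood of $u$.
   Formalization: The formal theorem assumes k ≥ 3; without this the claim fails: for k = 2, m ≥ 4 three vertices in one row of the rook graph are shattered (3 > 2), and for k = 1, m ≥ 2 a single vertex with a neighbour is shattered (1 > 0). -}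

module Defs where

open import Data.Bool.Properties using () renaming (_≟_ to _≟ᵇ_)
open import Data.Fin using (Fin)
open import Data.Fin.Properties using (_≟_; any?)
open import Data.Fin.Subset using (Subset; _⊆_; _∩_; ∣_∣; ⊥)
open import Data.Fin.Subset.Properties
  using (_⊆?_; anySubset?; ∣p∣≤n; ∣⊥∣≡0; ∉⊥; ⊆-antisym; ⊆-min; ∩-zeroʳ)
open import Data.List using (List; filter; upTo)
open import Data.List.Extrema.Nat using (max; xs≤max; argmax-sel)
open import Data.List.Membership.Propositional.Properties
  using (∈-filter⁺; ∈-filter⁻; ∈-upTo⁺)
open import Data.List.Relation.Unary.All using (lookup)
open import Data.Nat using (ℕ; suc; _^_; _≤_; s≤s)
open import Data.Nat.Properties using () renaming (_≟_ to _≟ⁿ_)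
open import Data.Product using (_×_; _,_; ∃-syntax; proj₂)
open import Data.Sum using (inj₁; inj₂)
import Data.Vec as Vec
open import Data.Vec.Functional using (Vector)
open import Data.Vec.Properties using (≡-dec)
open import Function using (id; _∘_)
open import Level using (0ℓ)
open import Relation.Binary using (Rel; Decidable; Symmetric; Irreflexive)
open import Relation.Binary.PropositionalEquality
  using (_≡_; _≢_; refl; sym; trans)
open import Relation.Nullary using (Dec; does; ¬?; _×-dec_; _→-dec_)
open import Relation.Nullary.Decidable using (map′; decidable-stable)
import Relation.Unary as U

record SimpleGraph (n : ℕ) : Set₁ where
  field
    Adj     : Rel (Fin n) 0ℓ
    adj?    : Decidable Adj
    irrefl  : Irreflexive _≡_ Adj
    symAdj  : Symmetric Adj

module _ {n : ℕ} (G : SimpleGraph n) where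
  open SimpleGraph G

  N : Fin n → Subset n
  N u = Vec.tabulate (λ v → does (adj? u v))

  Shattered : Subset n → Set
  Shattered S = ∀ A → A ⊆ S → ∃[ u ] N u ∩ S ≡ A

  ShattersOfSize : ℕ → Set
  ShattersOfSize d = ∃[ S ] Shattered S × ∣ S ∣ ≡ d

  private
    allSubset? : ∀ {P : Subset n → Set} → U.Decidable P → Dec (∀ A → P A)
    allSubset? P? = map′
      (λ ¬∃ A → decidable-stable (P? A) (λ ¬PA → ¬∃ (A , ¬PA)))
      (λ all (A , ¬PA) → ¬PA (all A))
      (¬? (anySubset? (¬? ∘ P?)))

  shattered? : U.Decidable Shattered
  shattered? S = allSubset? λ A →
    (A ⊆? S) →-dec any? (λ u → ≡-dec _≟ᵇ_ (N u ∩ S) A)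

  shattersOfSize? : U.Decidable ShattersOfSize
  shattersOfSize? d = anySubset? λ S → shattered? S ×-dec (∣ S ∣ ≟ⁿ d)

  shatteredSizes : List ℕ
  shatteredSizes = filter shattersOfSize? (upTo (suc n))

  -- The default 0 is only relevant to the graph without vertices, which
  -- shatters no set at all; see vcDim-attained.
  vcDim : ℕ
  vcDim = max 0 shatteredSizes

  ∣shattered∣≤vcDim : ∀ S → Shattered S → ∣ S ∣ ≤ vcDim
  ∣shattered∣≤vcDim S sh = lookup (xs≤max 0 shatteredSizes)
    (∈-filter⁺ shattersOfSize? (∈-upTo⁺ (s≤s (∣p∣≤n S))) (S , sh , refl))

  vcDim-attained : Fin n → ∃[ S ] Shattered S × ∣ S ∣ ≡ vcDim
  vcDim-attained u with argmax-sel id 0 shatteredSizes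
  ... | inj₂ d∈ = proj₂ (∈-filter⁻ shattersOfSize? {xs = upTo (suc n)} d∈)
  ... | inj₁ d≡0 = ⊥ , ⊥-shattered , trans (∣⊥∣≡0 n) (sym d≡0)
    where
    ⊥-shattered : Shattered ⊥
    ⊥-shattered A A⊆⊥ = u , trans (∩-zeroʳ (N u)) (⊆-antisym (⊆-min A) A⊆⊥)

record OrthogonalArray (k m : ℕ) : Set where
  field
    entry : Vector (Vector (Fin m) (m ^ 2)) k
    pairs : ∀ {i j} → i ≢ j → ∀ a b → ∃[ c ] entry i c ≡ a × entry j c ≡ b

-- Vertices are column indices.
oaGraph : ∀ {k m} → OrthogonalArray k m → SimpleGraph (m ^ 2)
oaGraph {k} {m} OA = record
  { Adj    = λ c d → c ≢ d × ∃[ i ] entry i c ≡ entry i d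
  ; adj?   = λ c d → ¬? (c ≟ d) ×-dec any? (λ i → entry i c ≟ entry i d)
  ; irrefl = λ c≡d (c≢d , _) → c≢d c≡d
  ; symAdj = λ (c≢d , i , eq) → (c≢d ∘ sym) , i , sym eq
  }
  where open OrthogonalArray OA

{-# OPTIONS --safe #-}

-- Let S be shattered and let u be adjacent to all of S.  The k lines through u
-- cover S, so if |S| > k(k-1) then some line L contains at least k points of S.
-- A vertex off L has at most k-1 neighbours on L, so every vertex adjacent to k
-- points of S ∩ L lies on L.  Such a vertex is adjacent to all of S ∩ L except
-- possibly itself, which forces |S ∩ L| ≤ k+1.  Now fix s in S off L.  For each
-- x in S off L there is a vertex adjacent, within S, to exactly S ∩ L together
-- with s and x; these vertices are distinct neighbours of s on L, so |S \ L| ≤ k-1.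
-- Hence |S| ≤ 2k ≤ k(k-1) after all, as k ≥ 3.
module Submission where

open import Defs
open import Data.Nat using (ℕ; _≤_; _*_; _∸_)
open import Data.Nat using (suc; zero; _+_; _^_; _<_; z≤n; s≤s; s≤s⁻¹; _≤?_)
open import Data.Nat.Properties
  using (≤-reflexive; ≤-trans; +-mono-≤; +-monoˡ-≤; *-monoˡ-≤; +-suc; +-comm;
         +-identityʳ; *-identityʳ; ≰⇒>; <⇒≱; 1+n≰n; module ≤-Reasoning)
open import Data.Bool using (true)
open import Data.Fin using (Fin; zero; suc; punchIn; punchOut; combine)
open import Data.Fin.Properties
  using (_≟_; any?; ¬Fin0; injective⇒≤; punchOut-injective; punchIn-punchOut; punchInᵢ≢i;
         combine-surjective)
open import Data.Fin.Subset
  using (Subset; _∈_; _∉_; _⊆_; _∩_; _∪_; ∁; ⊥; ⁅_⁆; ∣_∣; inside; outside)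
open import Data.Fin.Subset.Properties
  using (p⊆q⇒∣p∣≤∣q∣; ∣p∩q∣≤∣q∣; ∣⊥∣≡0; ∣⁅x⁆∣≡1; x∈⁅x⁆; x∈⁅y⁆⇒x≡y; x∈p∩q⁺; x∈p∩q⁻;
         x∈p∪q⁺; x∈p∪q⁻; p∩q⊆p; p∩q⊆q; x∈∁p⇒x∉p; nonempty?; ⊆-refl)
open import Data.List.Extrema.Nat using (max≤v⁺)
open import Data.List using (upTo)
open import Data.List.Relation.Unary.All using (map)
open import Data.List.Relation.Unary.All.Properties using (all-filter)
open import Data.Product using (_×_; _,_; ∃-syntax; proj₁; proj₂)
open import Data.Sum using (inj₁; inj₂)
open import Data.Vec using ([]; _∷_; tabulate)
open import Data.Vec.Properties using (lookup∘tabulate; []=⇒lookup; lookup⇒[]=)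
open import Function using (_∘_)
open import Relation.Binary.PropositionalEquality
  using (_≡_; _≢_; refl; sym; trans; cong; cong₂; subst)
open import Relation.Nullary using (Dec; yes; no; does; contradiction)
open import Relation.Nullary.Decidable using (decidable-stable; dec-true)
open import Relation.Unary using (Decidable)

-- Finite sets and their cardinalities.

-- A section `g` is injective. If it missed some `x`, punching `x` out of its codomain would leave
-- an injection into a set with one element fewer.
section⇒retraction : ∀ {n k} → n ≡ k → (f : Fin n → Fin k) (g : Fin k → Fin n) →
  (∀ y → f (g y) ≡ y) → ∀ x → g (f x) ≡ x
section⇒retraction {n} refl f g fg x with any? (λ y → g y ≟ x)
... | yes (y , refl) = cong g (fg y)
section⇒retraction {suc n} refl f g fg x | no x∉g =
  contradiction (injective⇒≤ g′-injective) 1+n≰n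
  where
  x≢g : ∀ y → x ≢ g y
  x≢g y x≡gy = x∉g (y , sym x≡gy)

  g′-injective : ∀ {y z} → punchOut (x≢g y) ≡ punchOut (x≢g z) → y ≡ z
  g′-injective {y} {z} eq = trans (sym (fg y))
    (trans (cong f (punchOut-injective (x≢g y) (x≢g z) eq)) (fg z))

module _ {n : ℕ} where

  ⟦_⟧ : ∀ {P : Fin n → Set} → Decidable P → Subset n
  ⟦ P? ⟧ = tabulate (does ∘ P?)

  module _ {P : Fin n → Set} (P? : Decidable P) where

    ∈⟦⟧⁺ : ∀ {x} → P x → x ∈ ⟦ P? ⟧
    ∈⟦⟧⁺ {x} Px =
      lookup⇒[]= x _ (trans (lookup∘tabulate (does ∘ P?) x) (dec-true (P? x) Px))

    ∈⟦⟧⁻ : ∀ {x} → x ∈ ⟦ P? ⟧ → P x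
    ∈⟦⟧⁻ {x} x∈ = witness (P? x)
      (trans (sym (lookup∘tabulate (does ∘ P?) x)) ([]=⇒lookup x∈))
      where
      witness : ∀ {Q : Set} (Q? : Dec Q) → does Q? ≡ true → Q
      witness (yes q) _ = q

∣p∣≡∣p∩q∣+∣p∩∁q∣ : ∀ {n} (p q : Subset n) → ∣ p ∣ ≡ ∣ p ∩ q ∣ + ∣ p ∩ ∁ q ∣
∣p∣≡∣p∩q∣+∣p∩∁q∣ []            []            = refl
∣p∣≡∣p∩q∣+∣p∩∁q∣ (outside ∷ p) (_ ∷ q)       = ∣p∣≡∣p∩q∣+∣p∩∁q∣ p q
∣p∣≡∣p∩q∣+∣p∩∁q∣ (inside ∷ p)  (inside ∷ q)  = cong suc (∣p∣≡∣p∩q∣+∣p∩∁q∣ p q)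
∣p∣≡∣p∩q∣+∣p∩∁q∣ (inside ∷ p)  (outside ∷ q) =
  trans (cong suc (∣p∣≡∣p∩q∣+∣p∩∁q∣ p q)) (sym (+-suc ∣ p ∩ q ∣ ∣ p ∩ ∁ q ∣))

empty⇒∣p∣≤ : ∀ {n b} {p : Subset n} → (∀ {x} → x ∉ p) → ∣ p ∣ ≤ b
empty⇒∣p∣≤ {n} x∉p = ≤-trans
  (p⊆q⇒∣p∣≤∣q∣ {q = ⊥} (λ x∈p → contradiction x∈p x∉p))
  (≤-trans (≤-reflexive (∣⊥∣≡0 n)) z≤n)

subsingleton⇒∣p∣≤1 : ∀ {n} {p : Subset n} →
  (∀ {x y} → x ∈ p → y ∈ p → x ≡ y) → ∣ p ∣ ≤ 1
subsingleton⇒∣p∣≤1 {p = p} same with nonempty? p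
... | no empty = empty⇒∣p∣≤ (λ x∈p → empty (_ , x∈p))
... | yes (x , x∈p) = ≤-trans
  (p⊆q⇒∣p∣≤∣q∣ (λ y∈p → subst (_∈ ⁅ x ⁆) (same x∈p y∈p) (x∈⁅x⁆ x)))
  (≤-reflexive (∣⁅x⁆∣≡1 x))

remove-point : ∀ {n b} {p : Subset n} → b < ∣ p ∣ →
  ∃[ x ] x ∈ p × b ≤ ∣ p ∩ ∁ ⁅ x ⁆ ∣
remove-point {p = p} b<∣p∣ with nonempty? p
... | no empty = contradiction (empty⇒∣p∣≤ (λ x∈p → empty (_ , x∈p))) (<⇒≱ b<∣p∣)
... | yes (x , x∈p) = x , x∈p , s≤s⁻¹ (begin
  suc _                               ≤⟨ b<∣p∣ ⟩
  ∣ p ∣                               ≡⟨ ∣p∣≡∣p∩q∣+∣p∩∁q∣ p ⁅ x ⁆ ⟩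
  ∣ p ∩ ⁅ x ⁆ ∣ + ∣ p ∩ ∁ ⁅ x ⁆ ∣     ≤⟨ +-monoˡ-≤ ∣ p ∩ ∁ ⁅ x ⁆ ∣ (∣p∩q∣≤∣q∣ p ⁅ x ⁆) ⟩
  ∣ ⁅ x ⁆ ∣ + ∣ p ∩ ∁ ⁅ x ⁆ ∣         ≡⟨ cong (_+ ∣ p ∩ ∁ ⁅ x ⁆ ∣) (∣⁅x⁆∣≡1 x) ⟩
  suc ∣ p ∩ ∁ ⁅ x ⁆ ∣                 ∎)
  where open ≤-Reasoning

∣cover∣≤ : ∀ {n l b} {p : Subset n} (q : Fin l → Subset n) →
  (∀ {x} → x ∈ p → ∃[ j ] x ∈ q j) → (∀ j → ∣ q j ∣ ≤ b) → ∣ p ∣ ≤ l * b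
∣cover∣≤ {l = zero} q covers small = empty⇒∣p∣≤ (¬Fin0 ∘ proj₁ ∘ covers)
∣cover∣≤ {l = suc l} {b} {p} q covers small = begin
  ∣ p ∣                                   ≡⟨ ∣p∣≡∣p∩q∣+∣p∩∁q∣ p (q zero) ⟩
  ∣ p ∩ q zero ∣ + ∣ p ∩ ∁ (q zero) ∣     ≤⟨ +-mono-≤
                                               (≤-trans (∣p∩q∣≤∣q∣ p (q zero)) (small zero))
                                               (∣cover∣≤ (q ∘ suc) covers′ (small ∘ suc)) ⟩
  b + l * b                               ∎
  where
  open ≤-Reasoning
  covers′ : ∀ {x} → x ∈ p ∩ ∁ (q zero) → ∃[ j ] x ∈ q (suc j)
  covers′ x∈ with x∈p∩q⁻ p _ x∈
  ... | x∈p , x∈∁q₀ with covers x∈p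
  ... | zero  , x∈q₀ = contradiction x∈q₀ (x∈∁p⇒x∉p x∈∁q₀)
  ... | suc j , x∈qⱼ = j , x∈qⱼ

-- Shattered sets and the VC-dimension.

module _ {n : ℕ} (G : SimpleGraph n) where
  open SimpleGraph G

  trace : ∀ {S} → Shattered G S → ∀ {A} → A ⊆ S →
    ∃[ w ] (∀ {x} → x ∈ A → Adj w x) × (∀ {x} → x ∈ S → Adj w x → x ∈ A)
  trace {S} sh {A} A⊆S with sh A A⊆S
  ... | w , N∩S≡A =
    w , (λ x∈A → ∈⟦⟧⁻ (adj? w) (p∩q⊆p (N G w) S (subst (_ ∈_) (sym N∩S≡A) x∈A)))
      , (λ x∈S wx → subst (_ ∈_) N∩S≡A (x∈p∩q⁺ (∈⟦⟧⁺ (adj? w) wx , x∈S)))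

  vcDim≤ : ∀ {b} → (∀ S → Shattered G S → ∣ S ∣ ≤ b) → vcDim G ≤ b
  -- `z≤n` takes care of the default value 0 of the maximum.
  vcDim≤ bound = max≤v⁺ z≤n
    (map (λ { (S , sh , refl) → bound S sh })
         (all-filter (shattersOfSize? G) (upTo (suc n))))

-- Lines of an orthogonal array with `suc c` rows.

module _ {c m : ℕ} (OA : OrthogonalArray (suc c) m) where
  open OrthogonalArray OA
  open SimpleGraph (oaGraph OA)

  -- Rows `i` and `j` realise all m² pairs of symbols on only m² columns, so the surjection `code`
  -- is also injective.
  agree-twice⇒≡ : ∀ {i j} → i ≢ j → ∀ {x y} →
    entry i x ≡ entry i y → entry j x ≡ entry j y → x ≡ y
  agree-twice⇒≡ {i} {j} i≢j {x} {y} eqᵢ eqⱼ =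
    trans (sym (retract x)) (trans (cong column (cong₂ combine eqᵢ eqⱼ)) (retract y))
    where
    code : Fin (m ^ 2) → Fin (m * m)
    code z = combine (entry i z) (entry j z)

    preimage : ∀ p → ∃[ z ] code z ≡ p
    preimage p with combine-surjective {m} {m} p
    ... | a , b , refl with pairs i≢j a b
    ... | z , refl , refl = z , refl

    column : Fin (m * m) → Fin (m ^ 2)
    column = proj₁ ∘ preimage

    retract : ∀ z → column (code z) ≡ z
    -- `m ^ 2` unfolds to `m * (m * 1)`.
    retract = section⇒retraction (cong (m *_) (*-identityʳ m)) code column
      (proj₂ ∘ preimage)

  -- Each line is a clique of the graph, and lines from different rows meet in at most one vertex.
  line : Fin (suc c) → Fin m → Subset (m ^ 2)
  line i a = ⟦ (λ x → entry i x ≟ a) ⟧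

  ∈line⁺ : ∀ {i a x} → entry i x ≡ a → x ∈ line i a
  ∈line⁺ {i} {a} = ∈⟦⟧⁺ (λ x → entry i x ≟ a)

  ∈line⁻ : ∀ {i a x} → x ∈ line i a → entry i x ≡ a
  ∈line⁻ {i} {a} = ∈⟦⟧⁻ (λ x → entry i x ≟ a)

  module _ {i : Fin (suc c)} {a : Fin m} where

    -- A vertex off the line can agree with a vertex on it only in one of the other `c` rows. Each
    -- such row accounts for at most one vertex of the line, by `agree-twice⇒≡`. The neighbours are
    -- indexed through `g`, so that the bound also counts points that merely label distinct
    -- neighbours.
    ∣neighbours-on-line∣≤ : ∀ {v} → entry i v ≢ a →
      ∀ {T} (g : Fin (m ^ 2) → Fin (m ^ 2)) →
      (∀ {x} → x ∈ T → entry i (g x) ≡ a) → (∀ {x} → x ∈ T → Adj v (g x)) →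
      (∀ {x y} → x ∈ T → y ∈ T → g x ≡ g y → x ≡ y) → ∣ T ∣ ≤ c
    ∣neighbours-on-line∣≤ {v} v∉L {T} g on-line adjacent injective =
      subst (∣ T ∣ ≤_) (*-identityʳ c)
        (∣cover∣≤ (λ j → T ∩ ⟦ agree? j ⟧) covers (λ j → subsingleton⇒∣p∣≤1 (same j)))
      where
      agree? : ∀ j → Decidable (λ x → entry (punchIn i j) v ≡ entry (punchIn i j) (g x))
      agree? j x = entry (punchIn i j) v ≟ entry (punchIn i j) (g x)

      covers : ∀ {x} → x ∈ T → ∃[ j ] x ∈ T ∩ ⟦ agree? j ⟧
      covers {x} x∈T with adjacent x∈T
      ... | _ , j , eq = punchOut i≢j , x∈p∩q⁺ (x∈T , ∈⟦⟧⁺ (agree? (punchOut i≢j))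
        (subst (λ r → entry r v ≡ entry r (g x)) (sym (punchIn-punchOut i≢j)) eq))
        where
        i≢j : i ≢ j
        i≢j refl = v∉L (trans eq (on-line x∈T))

      same : ∀ j {x y} → x ∈ T ∩ ⟦ agree? j ⟧ → y ∈ T ∩ ⟦ agree? j ⟧ → x ≡ y
      same j x∈ y∈ with x∈p∩q⁻ T _ x∈ | x∈p∩q⁻ T _ y∈
      ... | x∈T , x∈agree | y∈T , y∈agree = injective x∈T y∈T
        (agree-twice⇒≡ (punchInᵢ≢i i j ∘ sym)
          (trans (on-line x∈T) (sym (on-line y∈T)))
          (trans (sym (∈⟦⟧⁻ (agree? j) x∈agree)) (∈⟦⟧⁻ (agree? j) y∈agree)))

    many-neighbours⇒on-line : ∀ {T w} → c < ∣ T ∣ → T ⊆ line i a →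
      (∀ {x} → x ∈ T → Adj w x) → entry i w ≡ a
    many-neighbours⇒on-line c<∣T∣ T⊆L adjacent = decidable-stable (_ ≟ a) λ w∉L →
      <⇒≱ c<∣T∣ (∣neighbours-on-line∣≤ w∉L (λ x → x) (∈line⁻ ∘ T⊆L) adjacent (λ _ _ eq → eq))

    module _ {S : Subset (m ^ 2)} (sh : Shattered (oaGraph OA) S) where

      -- A vertex realising S ∩ L minus x and y lies on L, so being non-adjacent
      -- to x and to y it equals both.
      ∣S∩line∣≤ : ∣ S ∩ line i a ∣ ≤ suc (suc c)
      ∣S∩line∣≤ = decidable-stable (_ ≤? _) λ big →
        let T = S ∩ line i a
            -- `big` provides at least `c + 3` points. Removing two leaves `c + 1`, just enough for
            -- `many-neighbours⇒on-line`.
            x , x∈T , big′ = remove-point (≰⇒> big)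
            y , y∈T-x , big″ = remove-point big′
            T-x = T ∩ ∁ ⁅ x ⁆
            A = T-x ∩ ∁ ⁅ y ⁆
            A⊆T-x = p∩q⊆p T-x (∁ ⁅ y ⁆)
            T-x⊆T = p∩q⊆p T (∁ ⁅ x ⁆)
            w , adjacent , only = trace (oaGraph OA) sh {A}
              (p∩q⊆p S (line i a) ∘ T-x⊆T ∘ A⊆T-x)
            w∈L = many-neighbours⇒on-line big″
              (p∩q⊆q S (line i a) ∘ T-x⊆T ∘ A⊆T-x) adjacent
            missed⇒≡ : ∀ {z} → z ∈ T → z ∉ A → w ≡ z
            missed⇒≡ z∈T z∉A = decidable-stable (w ≟ _) λ w≢z →
              z∉A (only (p∩q⊆p S _ z∈T)
                (w≢z , i , trans w∈L (sym (∈line⁻ (p∩q⊆q S (line i a) z∈T)))))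
            x∉T-x = λ x∈ → x∈∁p⇒x∉p (p∩q⊆q T (∁ ⁅ x ⁆) x∈) (x∈⁅x⁆ x)
            y∉A = λ y∈ → x∈∁p⇒x∉p (p∩q⊆q T-x (∁ ⁅ y ⁆) y∈) (x∈⁅x⁆ y)
            y≡x = trans (sym (missed⇒≡ (T-x⊆T y∈T-x) y∉A))
                        (missed⇒≡ x∈T (x∉T-x ∘ A⊆T-x))
        in x∉T-x (subst (_∈ T-x) y≡x y∈T-x)

      -- Each point `x` of S off the line labels a neighbour `w x` of `s` on the line, and `w x`
      -- determines `x` through its trace on S.
      ∣S∖line∣≤ : c < ∣ S ∩ line i a ∣ → ∣ S ∩ ∁ (line i a) ∣ ≤ c
      ∣S∖line∣≤ big with nonempty? (S ∩ ∁ (line i a))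
      ... | no empty = empty⇒∣p∣≤ (λ x∈ → empty (_ , x∈))
      ... | yes (s , s∈R) = ∣neighbours-on-line∣≤ (off-line s∈R ∘ ∈line⁺) w
        (λ {x} _ → many-neighbours⇒on-line big (p∩q⊆q S (line i a))
          (adjacent x ∘ x∈p∪q⁺ ∘ inj₁))
        (λ {x} _ → symAdj (adjacent x (pair∈A x (in-S s∈R) (x∈p∪q⁺ (inj₁ (x∈⁅x⁆ s))))))
        w-injective
        where
        L = line i a
        R = S ∩ ∁ L

        in-S : R ⊆ S
        in-S = p∩q⊆p S (∁ L)

        off-line : ∀ {x} → x ∈ R → x ∉ L
        off-line x∈R = x∈∁p⇒x∉p (p∩q⊆q S (∁ L) x∈R)

        A : Fin (m ^ 2) → Subset (m ^ 2)
        -- Intersecting the pair with S keeps `A x` inside S for every `x`, so `w` is total. For `x`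
        -- equal to `s` the pair collapses, so `s` itself is counted too.
        A x = (S ∩ L) ∪ (S ∩ (⁅ s ⁆ ∪ ⁅ x ⁆))

        A⊆S : ∀ x → A x ⊆ S
        A⊆S x y∈A with x∈p∪q⁻ (S ∩ L) _ y∈A
        ... | inj₁ y∈ = p∩q⊆p S _ y∈
        ... | inj₂ y∈ = p∩q⊆p S _ y∈

        pair∈A : ∀ x {y} → y ∈ S → y ∈ ⁅ s ⁆ ∪ ⁅ x ⁆ → y ∈ A x
        pair∈A x y∈S y∈pair = x∈p∪q⁺ (inj₂ (x∈p∩q⁺ (y∈S , y∈pair)))

        w : Fin (m ^ 2) → Fin (m ^ 2)
        w x = proj₁ (trace (oaGraph OA) sh (A⊆S x))

        adjacent : ∀ x {y} → y ∈ A x → Adj (w x) y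
        adjacent x = proj₁ (proj₂ (trace (oaGraph OA) sh (A⊆S x)))

        only : ∀ x {y} → y ∈ S → Adj (w x) y → y ∈ A x
        only x = proj₂ (proj₂ (trace (oaGraph OA) sh (A⊆S x)))

        w≡⇒∈pair : ∀ {x y} → x ∈ R → w x ≡ w y → x ∈ ⁅ s ⁆ ∪ ⁅ y ⁆
        w≡⇒∈pair {x} {y} x∈R eq with x∈p∪q⁻ (S ∩ L) _ (only y (in-S x∈R)
          (subst (λ v → Adj v x) eq
            (adjacent x (pair∈A x (in-S x∈R) (x∈p∪q⁺ (inj₂ (x∈⁅x⁆ x)))))))
        ... | inj₁ x∈ = contradiction (p∩q⊆q S L x∈) (off-line x∈R)
        ... | inj₂ x∈ = p∩q⊆q S _ x∈

        w-injective : ∀ {x y} → x ∈ R → y ∈ R → w x ≡ w y → x ≡ y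
        w-injective {x} {y} x∈R y∈R eq
          -- Each of `x` and `y` is the other one or `s`. If neither is seen to be the other, both
          -- are `s`.
          with x∈p∪q⁻ ⁅ s ⁆ ⁅ y ⁆ (w≡⇒∈pair x∈R eq) | x∈p∪q⁻ ⁅ s ⁆ ⁅ x ⁆ (w≡⇒∈pair y∈R (sym eq))
        ... | inj₂ x∈ | _       = x∈⁅y⁆⇒x≡y y x∈
        ... | inj₁ _  | inj₂ y∈ = sym (x∈⁅y⁆⇒x≡y x y∈)
        ... | inj₁ x∈ | inj₁ y∈ = trans (x∈⁅y⁆⇒x≡y s x∈) (sym (x∈⁅y⁆⇒x≡y s y∈))

  ∣shattered∣≤ : 2 ≤ c → ∀ S → Shattered (oaGraph OA) S → ∣ S ∣ ≤ suc c * c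
  ∣shattered∣≤ 2≤c S sh with trace (oaGraph OA) sh (⊆-refl {x = S})
  -- `u` realises S itself, so the `suc c` lines through `u` cover S. If none of them holds more
  -- than `c` points of S, the bound is immediate.
  ... | u , adjacent , _ with any? (λ i → suc c ≤? ∣ S ∩ line i (entry i u) ∣)
  ... | no small = ∣cover∣≤ (λ i → S ∩ line i (entry i u)) covers
        (λ i → decidable-stable (_ ≤? _) (λ big → small (i , ≰⇒> big)))
    where
    covers : ∀ {x} → x ∈ S → ∃[ i ] x ∈ S ∩ line i (entry i u)
    covers x∈S with adjacent x∈S
    ... | _ , i , eq = i , x∈p∩q⁺ (x∈S , ∈line⁺ (sym eq))
  ... | yes (i , big) = begin
    ∣ S ∣                         ≡⟨ ∣p∣≡∣p∩q∣+∣p∩∁q∣ S L ⟩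
    ∣ S ∩ L ∣ + ∣ S ∩ ∁ L ∣       ≤⟨ +-mono-≤ (∣S∩line∣≤ sh) (∣S∖line∣≤ sh big) ⟩
    -- `2≤c` enters twice: as 2 ≤ c here, and below as 2c ≤ c².
    2 + c + c                     ≤⟨ +-monoˡ-≤ c (+-monoˡ-≤ c 2≤c) ⟩
    c + c + c                     ≡⟨ cong (λ z → c + z + c) (+-identityʳ c) ⟨
    2 * c + c                     ≤⟨ +-monoˡ-≤ c (*-monoˡ-≤ c 2≤c) ⟩
    c * c + c                     ≡⟨ +-comm (c * c) c ⟩
    suc c * c                     ∎
    where
    open ≤-Reasoning
    L = line i (entry i u)

theorem38 : ∀ (k m : ℕ) → 3 ≤ k → (OA : OrthogonalArray k m) →
    vcDim (oaGraph OA) ≤ k * (k ∸ 1)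
theorem38 (suc c) m (s≤s 2≤c) OA = vcDim≤ (oaGraph OA) (∣shattered∣≤ OA 2≤c)
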